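{- Let $\mathbb{F}$ be the Fano plane, i.e. the $3$-graph on vertex set $\{1,\dots,7\}$ with $3$-edges $123, 345, 156, 246, 147, 257, 367$. For every positive integer $n$, $$\mathrm{co^+ex}(n,\mathbb{F})\le \frac23 n .$$ Moreover, this bound is sharp when $n$ is divisible by $6$, i.e. $\mathrm{co^+ex}(n,\mathbb{F})=\frac23 n$ for every positive integer $n$ divisible by $6$.
   Context: A $3$-graph is a finite $3$-uniform hypergraph; an edge is written as the concatenation of its vertices. The minimum positive co-degree $\delta_2^+(H)$ of a non-empty $3$-graph $H$ is the maximum $k$ such that every pair of vertices contained in some edge of $H$ is contained in at least $k$ distinct edges of $H$; by convention it is $0$ if $H$ has no edges. A hypergraph is $F$-free if it has no (not necessarily induced) subhypergraph isomorphic to $F$. $\mathrm{co^+ex}(n,F)$ is the maximum of $\delta_2^+(H)$ over all $n$-vertex $F$-free $3$-graphs $H$. -}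

module Defs where

open import Data.Fin using (Fin; #_)
open import Data.Fin.Properties using (any?) renaming (_≟_ to _≟ᶠ_)
open import Data.Fin.Subset using (Subset; ⁅_⁆; _∪_; ∣_∣) renaming (_∈_ to _∈ˢ_)
open import Data.Fin.Subset.Properties using (_∈?_)
open import Data.Integer using (+_)
open import Data.List using (List; []; _∷_)
open import Data.List.Membership.Propositional using (_∈_)
open import Data.List.Relation.Unary.All using (All; []; _∷_)
open import Data.Nat using (ℕ; _≤_)
open import Data.Product using (∃; _×_)
open import Data.Rational using (ℚ; _/_)
open import Data.Sum using (_⊎_)
open import Data.Vec using (tabulate)
open import Function.Definitions using (Injective)
open import Relation.Binary.PropositionalEquality using (_≡_; _≢_; refl)
open import Relation.Nullary using (¬_; does; _×-dec_)

-- The list stands for the finite set of its members: everything below refers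
-- to it only through membership, so order and repetitions are irrelevant.
record 3-Graph (n : ℕ) : Set where
  field
    edges   : List (Subset n)
    uniform : All (λ e → ∣ e ∣ ≡ 3) edges

open 3-Graph public

Edge : ∀ {n} → 3-Graph n → Subset n → Set
Edge H e = e ∈ edges H

NonEmpty : ∀ {n} → 3-Graph n → Set
NonEmpty H = ∃ λ e → Edge H e

IsMaximum : (ℕ → Set) → ℕ → Set
IsMaximum P k = P k × (∀ j → P j → j ≤ k)

-- The pair {u, v} lies in at least k distinct edges.
InAtLeast : ∀ {n} → 3-Graph n → Fin n → Fin n → ℕ → Set
InAtLeast {n} H u v k = ∃ λ (f : Fin k → Subset n) →
  Injective _≡_ _≡_ f × (∀ i → Edge H (f i) × u ∈ˢ f i × v ∈ˢ f i)

PositiveCodegrees≥ : ∀ {n} → 3-Graph n → ℕ → Set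
PositiveCodegrees≥ H k = ∀ e u v →
  Edge H e → u ∈ˢ e → v ∈ˢ e → u ≢ v → InAtLeast H u v k

-- IsMinPositiveCodegree H k reads "δ₂⁺(H) = k".
IsMinPositiveCodegree : ∀ {n} → 3-Graph n → ℕ → Set
IsMinPositiveCodegree H k =
  (NonEmpty H × IsMaximum (PositiveCodegrees≥ H) k) ⊎ (¬ NonEmpty H × k ≡ 0)

image : ∀ {m n} → (Fin m → Fin n) → Subset m → Subset n
image φ e = tabulate λ v → does (any? λ u → (u ∈? e) ×-dec (φ u ≟ᶠ v))

-- A not necessarily induced copy of F in H.
Contains : ∀ {m n} → 3-Graph m → 3-Graph n → Set
Contains {m} {n} F H = ∃ λ (φ : Fin m → Fin n) →
  Injective _≡_ _≡_ φ × (∀ e → Edge F e → Edge H (image φ e))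

Free : ∀ {m n} → 3-Graph m → 3-Graph n → Set
Free F H = ¬ Contains F H

-- IsCo⁺ex n F k reads "co⁺ex(n, F) = k".  It determines k uniquely, but a
-- value exists only if there is an F-free 3-graph on n vertices.
IsCo⁺ex : ∀ {m} → ℕ → 3-Graph m → ℕ → Set
IsCo⁺ex n F = IsMaximum λ k →
  ∃ λ (H : 3-Graph n) → Free F H × IsMinPositiveCodegree H k

triple : ∀ {n} → Fin n → Fin n → Fin n → Subset n
triple a b c = ⁅ a ⁆ ∪ ⁅ b ⁆ ∪ ⁅ c ⁆

-- The edges 123, 345, 156, 246, 147, 257, 367, with point i written as i - 1.
fano : 3-Graph 7
fano .edges =
    triple (# 0) (# 1) (# 2)
  ∷ triple (# 2) (# 3) (# 4)
  ∷ triple (# 0) (# 4) (# 5)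
  ∷ triple (# 1) (# 3) (# 5)
  ∷ triple (# 0) (# 3) (# 6)
  ∷ triple (# 1) (# 4) (# 6)
  ∷ triple (# 2) (# 5) (# 6)
  ∷ []
fano .uniform = refl ∷ refl ∷ refl ∷ refl ∷ refl ∷ refl ∷ refl ∷ []

fromℕ : ℕ → ℚ
fromℕ n = + n / 1

⅔ : ℚ
⅔ = + 2 / 3

{-# OPTIONS --safe #-}

-- Upper bound: let abc be an edge of a 3-graph on n vertices with δ₂⁺ = k and
-- 3k > 2n, and write N(uv) for the codegree neighbourhood of a pair.  Any three
-- sets N(uv) of covered pairs have a common element, so one can choose in turn
--   d ∈ N(ab) ∩ N(ac) ∩ N(bc),   x ∈ N(ab) ∩ N(dc),
--   y ∈ N(ax) ∩ N(ac) ∩ N(db),   z ∈ N(xy) ∩ N(da) ∩ N(bc),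
-- and x, y, z, d, a, b, c span a Fano plane.
--
-- Sharpness: in a Fano plane any two points lie on a line, so a copy in a complete
-- 6-partite 3-graph would need seven distinct parts; with parts of size n/6, every
-- covered pair has codegree 4n/6.
--
-- Since the exact value is unknown for general n, the maximum is obtained by
-- deciding, for each k, whether a suitable 3-graph exists.
module Submission where

open import Defs
open import Data.Bool.Properties using () renaming (_≟_ to _≟ᵇ_)
open import Data.Fin using (Fin; zero; suc; punchIn; punchOut; combine; remQuot; quotient; remainder)
open import Data.Fin.Patterns using (0F; 1F; 2F; 3F; 4F; 5F; 6F)
open import Data.Fin.Properties using (any?; all?; pigeonhole; combine-injective; combine-remQuot; remQuot-combine; punchIn-injective; punchInᵢ≢i; punchIn-punchOut; <⇒≢) renaming (_≟_ to _≟ᶠ_)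
open import Data.Fin.Subset using (Subset; inside; outside; ⁅_⁆; _∪_; ∣_∣; _⊆_) renaming (_∈_ to _∈ˢ_; _∉_ to _∉ˢ_; ⊥ to ∅)
open import Data.Fin.Subset.Properties using (_∈?_; anySubset?; ⊆-antisym; ∣⊥∣≡0; ∣⁅x⁆∣≡1; x∈⁅x⁆; x∈⁅y⁆⇒x≡y; x∈p∪q⁻; x∈p∪q⁺; p⊆q⇒∣p∣≤∣q∣; p⊂q⇒∣p∣<∣q∣; ∪-identityˡ; ∪-assoc; ∪-comm)
open import Data.Integer using (+_)
import Data.Integer as ℤ
import Data.Integer.Properties as ℤ
open import Data.List using (List; []; _∷_; filter; map; _++_)
open import Data.List.Membership.Propositional using (_∈_; find)
open import Data.List.Membership.Propositional.Properties using (∈-filter⁺; ∈-filter⁻; ∈-++⁺ˡ; ∈-++⁺ʳ; ∈-map⁺)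
open import Data.List.Relation.Binary.Sublist.Propositional using ([]; _∷_; _∷ʳ_) renaming (_⊆_ to _⊑_)
open import Data.List.Relation.Binary.Sublist.Propositional.Properties using (filter-⊆)
import Data.List.Relation.Unary.All as All
open All using (All; []; _∷_)
import Data.List.Relation.Unary.All.Properties as All
import Data.List.Relation.Unary.Any as Any
open Any using (Any; here)
open import Data.Nat using (ℕ; zero; suc; z≤n; s≤s; s≤s⁻¹; NonZero) renaming (_+_ to _+ⁿ_; _*_ to _*ⁿ_; _≤_ to _≤ⁿ_; _<_ to _<ⁿ_)
import Data.Nat.Properties as ℕ
open import Data.Nat.Solver using (module +-*-Solver)
open +-*-Solver using (solve; con; _:*_; _:=_)
open import Data.Nat.Divisibility using (_∣_; divides)
open import Data.Product using (∃; _×_; _,_; proj₁; proj₂; uncurry)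
open import Data.Rational using (_≤_; _*_; toℚᵘ)
import Data.Rational.Properties as ℚ
open import Data.Rational.Unnormalised using (mkℚᵘ; *≤*; *≡*)
import Data.Rational.Unnormalised as ℚᵘ
import Data.Rational.Unnormalised.Properties as ℚᵘ
open import Data.Sum using (_⊎_; inj₁; inj₂; [_,_])
open import Data.Vec as Vec using ([]; _∷_)
import Data.Vec.Properties as Vec
open import Data.Vec.Relation.Unary.Unique.Propositional using (Unique; []; _∷_)
open import Data.Vec.Relation.Unary.Unique.Propositional.Properties using (lookup-injective)
open import Data.Vec.Relation.Unary.All using ([]; _∷_)
import Data.Vec.Functional as Vector
open import Function using (_∘_; case_of_; id; _⇔_; mk⇔)
open import Function.Definitions using (Injective)
open import Relation.Binary.Definitions using (DecidableEquality)
open import Relation.Binary.PropositionalEquality using (_≡_; _≢_; _≗_; refl; sym; trans; cong; cong₂; subst; subst₂; module ≡-Reasoning)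
open import Relation.Nullary using (Dec; yes; no; does; contradiction; ¬?; _×-dec_; _⊎-dec_; _→-dec_)
open import Relation.Nullary.Decidable using (map′; from-yes; does-⇔)
open import Relation.Unary using (Decidable)

private variable
  m n k : ℕ
  A : Set

-- Finite sets and triples

x∉p⇒∣⁅x⁆∪p∣≡1+∣p∣ : ∀ {x : Fin n} {p} → x ∉ˢ p → ∣ ⁅ x ⁆ ∪ p ∣ ≡ suc ∣ p ∣
x∉p⇒∣⁅x⁆∪p∣≡1+∣p∣ {x = zero}  {inside  ∷ p} x∉p = contradiction Vec.here x∉p
x∉p⇒∣⁅x⁆∪p∣≡1+∣p∣ {x = zero}  {outside ∷ p} x∉p = cong (suc ∘ ∣_∣) (∪-identityˡ p)
x∉p⇒∣⁅x⁆∪p∣≡1+∣p∣ {x = suc x} {inside  ∷ p} x∉p = cong suc (x∉p⇒∣⁅x⁆∪p∣≡1+∣p∣ (x∉p ∘ Vec.there))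
x∉p⇒∣⁅x⁆∪p∣≡1+∣p∣ {x = suc x} {outside ∷ p} x∉p = x∉p⇒∣⁅x⁆∪p∣≡1+∣p∣ (x∉p ∘ Vec.there)

∣⁅x⁆∪⁅y⁆∣≡2 : ∀ {x y : Fin n} → x ≢ y → ∣ ⁅ x ⁆ ∪ ⁅ y ⁆ ∣ ≡ 2
∣⁅x⁆∪⁅y⁆∣≡2 {y = y} x≢y =
  trans (x∉p⇒∣⁅x⁆∪p∣≡1+∣p∣ (x≢y ∘ x∈⁅y⁆⇒x≡y y)) (cong suc (∣⁅x⁆∣≡1 y))

∣q∣<∣p∣⇒∃∈p∉q : ∀ {p q : Subset n} → ∣ q ∣ <ⁿ ∣ p ∣ → ∃ λ x → x ∈ˢ p × x ∉ˢ q
∣q∣<∣p∣⇒∃∈p∉q {p = p} {q} ∣q∣<∣p∣ with any? (λ x → (x ∈? p) ×-dec ¬? (x ∈? q))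
... | yes found = found
... | no  none  = contradiction (p⊆q⇒∣p∣≤∣q∣ p⊆q) (ℕ.<⇒≱ ∣q∣<∣p∣)
  where
  p⊆q : p ⊆ q
  p⊆q {x} x∈p with x ∈? q
  ... | yes x∈q = x∈q
  ... | no  x∉q = contradiction (x , x∈p , x∉q) none

∣q∣≤∣p∣∧p⊆q⇒p≡q : ∀ {p q : Subset n} → ∣ q ∣ ≤ⁿ ∣ p ∣ → p ⊆ q → p ≡ q
∣q∣≤∣p∣∧p⊆q⇒p≡q {p = p} {q} ∣q∣≤∣p∣ p⊆q = ⊆-antisym p⊆q q⊆p
  where
  q⊆p : q ⊆ p
  q⊆p {x} x∈q with x ∈? p
  ... | yes x∈p = x∈p
  ... | no  x∉p = contradiction (p⊂q⇒∣p∣<∣q∣ (p⊆q , x , x∈q , x∉p)) (ℕ.≤⇒≯ ∣q∣≤∣p∣)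

module _ {a b c : Fin n} where

  ∈-triple⁻ : ∀ {x} → x ∈ˢ triple a b c → x ≡ a ⊎ x ≡ b ⊎ x ≡ c
  ∈-triple⁻ x∈abc with x∈p∪q⁻ ⁅ a ⁆ (⁅ b ⁆ ∪ ⁅ c ⁆) x∈abc
  ... | inj₁ x∈a = inj₁ (x∈⁅y⁆⇒x≡y a x∈a)
  ... | inj₂ x∈bc with x∈p∪q⁻ ⁅ b ⁆ ⁅ c ⁆ x∈bc
  ...   | inj₁ x∈b = inj₂ (inj₁ (x∈⁅y⁆⇒x≡y b x∈b))
  ...   | inj₂ x∈c = inj₂ (inj₂ (x∈⁅y⁆⇒x≡y c x∈c))

  ∈-triple₁ : a ∈ˢ triple a b c
  ∈-triple₁ = x∈p∪q⁺ (inj₁ (x∈⁅x⁆ a))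

  ∈-triple₂ : b ∈ˢ triple a b c
  ∈-triple₂ = x∈p∪q⁺ (inj₂ (x∈p∪q⁺ (inj₁ (x∈⁅x⁆ b))))

  ∈-triple₃ : c ∈ˢ triple a b c
  ∈-triple₃ = x∈p∪q⁺ (inj₂ (x∈p∪q⁺ (inj₂ (x∈⁅x⁆ c))))

  triple-⊆ : ∀ {p} → a ∈ˢ p → b ∈ˢ p → c ∈ˢ p → triple a b c ⊆ p
  triple-⊆ a∈p b∈p c∈p x∈abc with ∈-triple⁻ x∈abc
  ... | inj₁ refl        = a∈p
  ... | inj₂ (inj₁ refl) = b∈p
  ... | inj₂ (inj₂ refl) = c∈p

  ∣triple∣≡3 : a ≢ b → a ≢ c → b ≢ c → ∣ triple a b c ∣ ≡ 3
  ∣triple∣≡3 a≢b a≢c b≢c =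
    trans (x∉p⇒∣⁅x⁆∪p∣≡1+∣p∣ a∉bc) (cong suc (∣⁅x⁆∪⁅y⁆∣≡2 b≢c))
    where
    a∉bc : a ∉ˢ ⁅ b ⁆ ∪ ⁅ c ⁆
    a∉bc = [ a≢b ∘ x∈⁅y⁆⇒x≡y b , a≢c ∘ x∈⁅y⁆⇒x≡y c ] ∘ x∈p∪q⁻ ⁅ b ⁆ ⁅ c ⁆

triple-rotate : ∀ (a b c : Fin n) → triple a b c ≡ triple c a b
triple-rotate a b c =
  trans (sym (∪-assoc ⁅ a ⁆ ⁅ b ⁆ ⁅ c ⁆)) (∪-comm (⁅ a ⁆ ∪ ⁅ b ⁆) ⁅ c ⁆)

triple-injective₃ : ∀ {u v w w′ : Fin n} → w ≢ u → w ≢ v →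
  triple u v w ≡ triple u v w′ → w ≡ w′
triple-injective₃ {u = u} {v} {w} w≢u w≢v eq
  with ∈-triple⁻ (subst (w ∈ˢ_) eq (∈-triple₃ {a = u} {v}))
... | inj₁ w≡u         = contradiction w≡u w≢u
... | inj₂ (inj₁ w≡v)  = contradiction w≡v w≢v
... | inj₂ (inj₂ w≡w′) = w≡w′

x∈p∧y∉p⇒x≢y : ∀ {p : Subset n} {x y} → x ∈ˢ p → y ∉ˢ p → x ≢ y
x∈p∧y∉p⇒x≢y x∈p y∉p refl = y∉p x∈p

third-vertex : ∀ {e : Subset n} {u v} → ∣ e ∣ ≡ 3 → u ∈ˢ e → v ∈ˢ e → u ≢ v →
  ∃ λ w → triple u v w ≡ e × u ≢ w × v ≢ w
third-vertex {e = e} {u} {v} ∣e∣≡3 u∈e v∈e u≢v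
  with w , w∈e , w∉uv ← ∣q∣<∣p∣⇒∃∈p∉q {p = e} {⁅ u ⁆ ∪ ⁅ v ⁆}
         (ℕ.≤-reflexive (trans (cong suc (∣⁅x⁆∪⁅y⁆∣≡2 u≢v)) (sym ∣e∣≡3)))
  = w , ∣q∣≤∣p∣∧p⊆q⇒p≡q (ℕ.≤-reflexive (trans ∣e∣≡3 (sym (∣triple∣≡3 u≢v u≢w v≢w))))
          (triple-⊆ u∈e v∈e w∈e)
      , u≢w , v≢w
  where
  u≢w : u ≢ w
  u≢w = x∈p∧y∉p⇒x≢y (x∈p∪q⁺ (inj₁ (x∈⁅x⁆ u))) w∉uv
  v≢w : v ≢ w
  v≢w = x∈p∧y∉p⇒x≢y (x∈p∪q⁺ (inj₂ (x∈⁅x⁆ v))) w∉uv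

-- Images of vertex sets

∈-image : ∀ (φ : Fin m → Fin n) e {v} → v ∈ˢ image φ e ⇔ (∃ λ u → u ∈ˢ e × φ u ≡ v)
∈-image φ e {v} = mk⇔ to from
  where
  preimage? : ∀ v → Dec (∃ λ u → u ∈ˢ e × φ u ≡ v)
  preimage? v = any? λ u → (u ∈? e) ×-dec (φ u ≟ᶠ v)

  lookup-image : Vec.lookup (image φ e) v ≡ does (preimage? v)
  lookup-image = Vec.lookup∘tabulate (does ∘ preimage?) v

  to : v ∈ˢ image φ e → ∃ λ u → u ∈ˢ e × φ u ≡ v
  to v∈φe with preimage? v | trans (sym lookup-image) (Vec.[]=⇒lookup v∈φe)
  ... | yes found | _ = found

  from : (∃ λ u → u ∈ˢ e × φ u ≡ v) → v ∈ˢ image φ e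
  -- Two decisions of one proposition carry the same Boolean, so `preimage? v` can be compared with
  -- `yes found`, whose Boolean is `inside`.
  from found = Vec.lookup⇒[]= v _ (trans lookup-image (does-⇔ (mk⇔ id id) (preimage? v) (yes found)))

open Function.Equivalence using (to; from)

image-triple : ∀ (φ : Fin m → Fin n) a b c →
  image φ (triple a b c) ≡ triple (φ a) (φ b) (φ c)
image-triple φ a b c = ⊆-antisym image⊆triple
  (triple-⊆ (from (∈-image φ _) (a , ∈-triple₁ , refl))
            (from (∈-image φ _) (b , ∈-triple₂ {a = a} , refl))
            (from (∈-image φ _) (c , ∈-triple₃ {a = a} {b} , refl)))
  where
  image⊆triple : image φ (triple a b c) ⊆ triple (φ a) (φ b) (φ c)
  image⊆triple v∈ with to (∈-image φ _) v∈
  ... | u , u∈abc , refl with ∈-triple⁻ u∈abc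
  ...   | inj₁ refl        = ∈-triple₁
  ...   | inj₂ (inj₁ refl) = ∈-triple₂ {a = φ a}
  ...   | inj₂ (inj₂ refl) = ∈-triple₃ {a = φ a} {φ b}

image-cong-⊆ : ∀ (φ ψ : Fin m → Fin n) → φ ≗ ψ → ∀ e → image φ e ⊆ image ψ e
image-cong-⊆ φ ψ φ≗ψ e v∈φe with to (∈-image φ e) v∈φe
... | u , u∈e , refl = from (∈-image ψ e) (u , u∈e , sym (φ≗ψ u))

image-cong : ∀ {φ ψ : Fin m → Fin n} → φ ≗ ψ → image φ ≗ image ψ
image-cong {φ = φ} {ψ} φ≗ψ e =
  ⊆-antisym (image-cong-⊆ φ ψ φ≗ψ e) (image-cong-⊆ ψ φ (sym ∘ φ≗ψ) e)

-- The upper bound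

module _ (f g h : Fin k → Fin n)
  (f-inj : Injective _≡_ _≡_ f) (g-inj : Injective _≡_ _≡_ g) (h-inj : Injective _≡_ _≡_ h)
  where

  private
    InImages : Set
    InImages = ∃ λ w → (∃ λ i → f i ≡ w) × (∃ λ i → g i ≡ w) × (∃ λ i → h i ≡ w)

    f-hits? : ∀ w → Dec (∃ λ i → f i ≡ w)
    f-hits? w = any? λ i → f i ≟ᶠ w

    flag : ∀ {P : Set} → Dec P → Fin 2
    flag (yes _) = 1F
    flag (no  _) = 0F

    -- f goes to the first copy of Fin n and h to the second; g goes to the second
    -- copy exactly where it would collide with f.
    copy : Fin 3 × Fin k → Fin 2
    copy (0F , i) = 0F
    copy (1F , i) = flag (f-hits? (g i))
    copy (2F , i) = 1F

    value : Fin 3 × Fin k → Fin n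
    value (0F , i) = f i
    value (1F , i) = g i
    value (2F , i) = h i

    collide₀₁ : ∀ i j → copy (0F , i) ≡ copy (1F , j) → f i ≢ g j
    collide₀₁ i j c v with f-hits? (g j)
    -- In the `yes` case `c` would identify the two copies of `Fin n`, so only `no` remains;
    -- `collide₁₂` drops `no` for the same reason.
    ... | no miss = miss (i , v)

    collide₁₂ : ∀ i j → copy (1F , i) ≡ copy (2F , j) → g i ≡ h j → InImages
    collide₁₂ i j c v with f-hits? (g i)
    ... | yes hit = g i , hit , (i , refl) , (j , sym v)

    -- Each family is injective, f and h occupy different copies, and `copy` keeps g away from f.
    -- What is left is g meeting h in the second copy, where the value of g is also a value of f.
    collision : ∀ x y → copy x ≡ copy y → value x ≡ value y → InImages ⊎ x ≡ y
    collision (0F , i) (0F , j) c v = inj₂ (cong (0F ,_) (f-inj v))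
    collision (0F , i) (1F , j) c v = contradiction v (collide₀₁ i j c)
    collision (0F , i) (2F , j) ()
    collision (1F , i) (0F , j) c v = contradiction (sym v) (collide₀₁ j i (sym c))
    collision (1F , i) (1F , j) c v = inj₂ (cong (1F ,_) (g-inj v))
    collision (1F , i) (2F , j) c v = inj₁ (collide₁₂ i j c v)
    collision (2F , i) (0F , j) ()
    collision (2F , i) (1F , j) c v = inj₁ (collide₁₂ j i (sym c) (sym v))
    collision (2F , i) (2F , j) c v = inj₂ (cong (2F ,_) (h-inj v))

    index : Fin (3 *ⁿ k) → Fin 3 × Fin k
    index = remQuot {3} k

    index-injective : ∀ x y → index x ≡ index y → x ≡ y
    index-injective x y eq =
      trans (sym (combine-remQuot {3} k x)) (trans (cong (uncurry combine) eq) (combine-remQuot {3} k y))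

  -- If no value were hit by all three maps, `copy` and `value` together would embed 3k indices into
  -- two copies of `Fin n`, against 2n < 3k.
  common-value : 2 *ⁿ n <ⁿ 3 *ⁿ k →
    ∃ λ w → (∃ λ i → f i ≡ w) × (∃ λ i → g i ≡ w) × (∃ λ i → h i ≡ w)
  common-value 2n<3k
    with x , y , x<y , eq ← pigeonhole 2n<3k (λ x → combine (copy (index x)) (value (index x)))
    with c , v ← combine-injective (copy (index x)) (value (index x)) (copy (index y)) (value (index y)) eq
    with collision (index x) (index y) c v
  ... | inj₁ found = found
  ... | inj₂ same  = contradiction (index-injective x y same) (<⇒≢ x<y)

-- From large codegrees to a Fano plane

module _ {n} (H : 3-Graph n) where

  -- The inequalities travel with the edge: any two points of a Fano plane lie on exactly one line,
  -- so seven proper edges supply all 21 inequalities that `fano-copy` needs.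
  ProperEdge : Fin n → Fin n → Fin n → Set
  ProperEdge a b c = Edge H (triple a b c) × a ≢ b × a ≢ c × b ≢ c

  Covered : Fin n → Fin n → Set
  Covered u v = ∃ λ e → Edge H e × u ∈ˢ e × v ∈ˢ e × u ≢ v

  -- Replaces edges through a pair by their third vertices. An edge is recovered from its third
  -- vertex as `triple u v w`, so distinct edges give distinct vertices.
  codegree-neighbours : ∀ {u v} → u ≢ v → InAtLeast H u v k →
    ∃ λ (w : Fin k → Fin n) → Injective _≡_ _≡_ w × (∀ i → ProperEdge u v (w i))
  codegree-neighbours {k} {u} {v} u≢v (f , f-inj , f-edge) = w , w-inj , w-edge
    where
    w-spec : ∀ i → ∃ λ w → triple u v w ≡ f i × u ≢ w × v ≢ w
    w-spec i = let e∈H , u∈e , v∈e = f-edge i in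
      third-vertex (All.lookup (uniform H) e∈H) u∈e v∈e u≢v

    w : Fin k → Fin n
    w i = proj₁ (w-spec i)

    w-inj : Injective _≡_ _≡_ w
    w-inj {i} {j} eq = f-inj (trans (sym (proj₁ (proj₂ (w-spec i))))
      (trans (cong (triple u v) eq) (proj₁ (proj₂ (w-spec j)))))

    w-edge : ∀ i → ProperEdge u v (w i)
    w-edge i = let _ , eq , u≢w , v≢w = w-spec i in
      subst (Edge H) (sym eq) (proj₁ (f-edge i)) , u≢v , u≢w , v≢w

  nonEmpty⇒properEdge : NonEmpty H → ∃ λ a → ∃ λ b → ∃ λ c → ProperEdge a b c
  nonEmpty⇒properEdge (e , e∈H)
    with ∣e∣≡3 ← All.lookup (uniform H) e∈H
    with a , a∈e , _ ← ∣q∣<∣p∣⇒∃∈p∉q {p = e} {∅}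
           (subst (_<ⁿ ∣ e ∣) (sym (∣⊥∣≡0 n)) (subst (0 <ⁿ_) (sym ∣e∣≡3) (s≤s z≤n)))
    with b , b∈e , b∉a ← ∣q∣<∣p∣⇒∃∈p∉q {p = e} {⁅ a ⁆}
           (subst (_<ⁿ ∣ e ∣) (sym (∣⁅x⁆∣≡1 a)) (subst (1 <ⁿ_) (sym ∣e∣≡3) (s≤s (s≤s z≤n))))
    with a≢b ← x∈p∧y∉p⇒x≢y (x∈⁅x⁆ a) b∉a
    with c , refl , a≢c , b≢c ← third-vertex ∣e∣≡3 a∈e b∈e a≢b
    = a , b , c , e∈H , a≢b , a≢c , b≢c

  fano-copy : ∀ {x y z d a b c} → ProperEdge x y z → ProperEdge d a z → ProperEdge a b x →
    ProperEdge d b y → ProperEdge d c x → ProperEdge a c y → ProperEdge b c z → Contains fano H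
  fano-copy {x} {y} {z} {d} {a} {b} {c}
    (xyz∈H , x≢y , x≢z , y≢z) (daz∈H , d≢a , d≢z , a≢z) (abx∈H , a≢b , a≢x , b≢x)
    (dby∈H , d≢b , d≢y , b≢y) (dcx∈H , d≢c , d≢x , c≢x) (acy∈H , a≢c , a≢y , c≢y)
    (bcz∈H , b≢c , b≢z , c≢z)
    = φ , (λ {i} {j} → lookup-injective distinct i j) , λ e → All.lookup lines
    where
    φ : Fin 7 → Fin n
    φ = Vec.lookup (x ∷ y ∷ z ∷ d ∷ a ∷ b ∷ c ∷ [])

    distinct : Unique (x ∷ y ∷ z ∷ d ∷ a ∷ b ∷ c ∷ [])
    distinct = (x≢y ∷ x≢z ∷ d≢x ∘ sym ∷ a≢x ∘ sym ∷ b≢x ∘ sym ∷ c≢x ∘ sym ∷ [])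
             ∷ (y≢z ∷ d≢y ∘ sym ∷ a≢y ∘ sym ∷ b≢y ∘ sym ∷ c≢y ∘ sym ∷ [])
             ∷ (d≢z ∘ sym ∷ a≢z ∘ sym ∷ b≢z ∘ sym ∷ c≢z ∘ sym ∷ [])
             ∷ (d≢a ∷ d≢b ∷ d≢c ∷ [])
             ∷ (a≢b ∷ a≢c ∷ [])
             ∷ (b≢c ∷ [])
             ∷ []
             ∷ []

    line : ∀ i j l → Edge H (triple (φ i) (φ j) (φ l)) → Edge H (image φ (triple i j l))
    line i j l = subst (Edge H) (sym (image-triple φ i j l))

    -- Common neighbours arrive as the last vertex of an edge, whereas the lines of `fano` other
    -- than the first list the corresponding point x, y or z first.
    rotated : ∀ {u v w} → Edge H (triple u v w) → Edge H (triple w u v)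
    rotated {u} {v} {w} = subst (Edge H) (triple-rotate u v w)

    lines : All (Edge H ∘ image φ) (edges fano)
    lines = line 0F 1F 2F xyz∈H
          ∷ line 2F 3F 4F (rotated daz∈H)
          ∷ line 0F 4F 5F (rotated abx∈H)
          ∷ line 1F 3F 5F (rotated dby∈H)
          ∷ line 0F 3F 6F (rotated dcx∈H)
          ∷ line 1F 4F 6F (rotated acy∈H)
          ∷ line 2F 5F 6F (rotated bcz∈H)
          ∷ []

  module _ {k} (δ≥k : PositiveCodegrees≥ H k) (2n<3k : 2 *ⁿ n <ⁿ 3 *ⁿ k) where

    neighbours : ∀ {u v} → Covered u v →
      ∃ λ (w : Fin k → Fin n) → Injective _≡_ _≡_ w × (∀ i → ProperEdge u v (w i))
    neighbours (e , e∈H , u∈e , v∈e , u≢v) =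
      codegree-neighbours u≢v (δ≥k e _ _ e∈H u∈e v∈e u≢v)

    -- Each pair has k distinct codegree neighbours, and 3k > 2n makes `common-value` applicable.
    -- The three pairs may coincide.
    common-neighbour : ∀ {u₁ v₁ u₂ v₂ u₃ v₃} →
      Covered u₁ v₁ → Covered u₂ v₂ → Covered u₃ v₃ →
      ∃ λ w → ProperEdge u₁ v₁ w × ProperEdge u₂ v₂ w × ProperEdge u₃ v₃ w
    common-neighbour c₁ c₂ c₃
      with f , f-inj , f-edge ← neighbours c₁
      with g , g-inj , g-edge ← neighbours c₂
      with h , h-inj , h-edge ← neighbours c₃
      with common-value f g h f-inj g-inj h-inj 2n<3k
    ... | w , (i , refl) , (j , gj≡w) , (l , hl≡w) =
      w , f-edge i , subst (ProperEdge _ _) gj≡w (g-edge j) , subst (ProperEdge _ _) hl≡w (h-edge l)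

    covered₁₂ : ∀ {a b c} → ProperEdge a b c → Covered a b
    covered₁₂ {a} (e∈H , a≢b , _) = _ , e∈H , ∈-triple₁ , ∈-triple₂ {a = a} , a≢b

    covered₁₃ : ∀ {a b c} → ProperEdge a b c → Covered a c
    covered₁₃ {a} {b} (e∈H , _ , a≢c , _) = _ , e∈H , ∈-triple₁ , ∈-triple₃ {a = a} {b} , a≢c

    covered₂₃ : ∀ {a b c} → ProperEdge a b c → Covered b c
    covered₂₃ {a} {b} (e∈H , _ , _ , b≢c) = _ , e∈H , ∈-triple₂ {a = a} , ∈-triple₃ {a = a} {b} , b≢c

    covered-sym : ∀ {u v} → Covered u v → Covered v u
    covered-sym (e , e∈H , u∈e , v∈e , u≢v) = e , e∈H , v∈e , u∈e , u≢v ∘ sym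

    contains-fano : NonEmpty H → Contains fano H
    contains-fano nonEmpty =
      case nonEmpty⇒properEdge nonEmpty of λ
        (a , b , c , abc) →
      -- The order of choices ensures that every pair is covered when it is used: dc by acd, ax by
      -- abx, db and da by abd, xy by axy, the others by abc.
      case common-neighbour (covered₁₂ abc) (covered₁₃ abc) (covered₂₃ abc) of λ
        (d , abd , acd , _) →
      -- Only the pairs ab and dc constrain x; ab is repeated to fill the third place.
      case common-neighbour (covered₁₂ abc) (covered-sym (covered₂₃ acd)) (covered₁₂ abc) of λ
        (x , abx , dcx , _) →
      case common-neighbour (covered₁₃ abx) (covered₁₃ abc) (covered-sym (covered₂₃ abd)) of λ
        (y , axy , acy , dby) →
      case common-neighbour (covered₂₃ axy) (covered-sym (covered₁₃ abd)) (covered₂₃ abc) of λ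
        (z , xyz , daz , bcz) →
      fano-copy xyz daz abx dby dcx acy bcz

-- Complete multipartite 3-graphs

subsets : ∀ n → List (Subset n)
subsets zero    = [] ∷ []
subsets (suc n) = map (inside ∷_) (subsets n) ++ map (outside ∷_) (subsets n)

∈-subsets : ∀ (p : Subset n) → p ∈ subsets n
∈-subsets             []            = here refl
∈-subsets             (inside  ∷ p) = ∈-++⁺ˡ (∈-map⁺ (inside ∷_) (∈-subsets p))
∈-subsets {n = suc n} (outside ∷ p) = ∈-++⁺ʳ (map (inside ∷_) (subsets n)) (∈-map⁺ (outside ∷_) (∈-subsets p))

-- Verified by evaluating the decision procedure on all 49 ordered pairs.
collinear : ∀ i j → Any (λ e → i ∈ˢ e × j ∈ˢ e) (edges fano)
collinear = from-yes (all? λ i → all? λ j →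
  Any.any? (λ e → (i ∈? e) ×-dec (j ∈? e)) (edges fano))

-- The parts have size q, and there are 2 + s of them: the residue classes of the
-- identification Fin (q * (2 + s)) ≅ Fin q × Fin (2 + s).
module Multipartite (q s : ℕ) where

  private
    V : ℕ
    V = q *ⁿ (2 +ⁿ s)

  part : Fin V → Fin (2 +ⁿ s)
  part = remainder {q} (2 +ⁿ s)

  part-combine : ∀ i j → part (combine i j) ≡ j
  part-combine i j = cong proj₂ (remQuot-combine {q} i j)

  Rainbow : Subset V → Set
  Rainbow e = ∀ u v → u ∈ˢ e → v ∈ˢ e → part u ≡ part v → u ≡ v

  rainbow? : Decidable Rainbow
  rainbow? e = all? λ u → all? λ v →
    (u ∈? e) →-dec (v ∈? e) →-dec (part u ≟ᶠ part v) →-dec (u ≟ᶠ v)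

  rainbowTriple? : Decidable λ (e : Subset V) → ∣ e ∣ ≡ 3 × Rainbow e
  rainbowTriple? e = (∣ e ∣ ℕ.≟ 3) ×-dec rainbow? e

  multipartite : 3-Graph V
  multipartite .edges   = filter rainbowTriple? (subsets V)
  multipartite .uniform = All.map proj₁ (All.all-filter rainbowTriple? (subsets V))

  edge⇒rainbow : ∀ {e} → Edge multipartite e → Rainbow e
  edge⇒rainbow e∈H = proj₂ (proj₂ (∈-filter⁻ rainbowTriple? {xs = subsets V} e∈H))

  distinctParts⇒edge : ∀ {u v w} → part u ≢ part v → part u ≢ part w → part v ≢ part w →
    Edge multipartite (triple u v w)
  distinctParts⇒edge {u} {v} {w} u≁v u≁w v≁w = ∈-filter⁺ rainbowTriple? (∈-subsets _)
    (∣triple∣≡3 (u≁v ∘ cong part) (u≁w ∘ cong part) (v≁w ∘ cong part) , rainbow)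
    where
    rainbow : Rainbow (triple u v w)
    rainbow x y x∈ y∈ x∼y with ∈-triple⁻ x∈ | ∈-triple⁻ y∈
    ... | inj₁ refl        | inj₁ refl        = refl
    ... | inj₁ refl        | inj₂ (inj₁ refl) = contradiction x∼y u≁v
    ... | inj₁ refl        | inj₂ (inj₂ refl) = contradiction x∼y u≁w
    ... | inj₂ (inj₁ refl) | inj₁ refl        = contradiction (sym x∼y) u≁v
    ... | inj₂ (inj₁ refl) | inj₂ (inj₁ refl) = refl
    ... | inj₂ (inj₁ refl) | inj₂ (inj₂ refl) = contradiction x∼y v≁w
    ... | inj₂ (inj₂ refl) | inj₁ refl        = contradiction (sym x∼y) u≁w
    ... | inj₂ (inj₂ refl) | inj₂ (inj₁ refl) = contradiction (sym x∼y) v≁w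
    ... | inj₂ (inj₂ refl) | inj₂ (inj₂ refl) = refl

  multipartite-nonEmpty : ∀ (i : Fin q) {a b c} → a ≢ b → a ≢ c → b ≢ c → NonEmpty multipartite
  multipartite-nonEmpty i a≢b a≢c b≢c =
    _ , distinctParts⇒edge (distinct a≢b) (distinct a≢c) (distinct b≢c)
    where
    distinct : ∀ {a b} → a ≢ b → part (combine i a) ≢ part (combine i b)
    distinct {a} {b} a≢b eq = a≢b (trans (sym (part-combine i a)) (trans eq (part-combine i b)))

  -- A covered pair meets two different parts, and every vertex of the other s parts, each of size
  -- q, completes it to an edge.
  multipartite-codegrees : PositiveCodegrees≥ multipartite (q *ⁿ s)
  multipartite-codegrees e u v e∈H u∈e v∈e u≢v =
    triple u v ∘ w ,
    (w-inj _ _ ∘ triple-injective₃ (w≁u _ ∘ cong part) (w≁v _ ∘ cong part)) ,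
    λ i → distinctParts⇒edge u≁v (w≁u i ∘ sym) (w≁v i ∘ sym) , ∈-triple₁ , ∈-triple₂ {a = u}
    where
    u≁v : part u ≢ part v
    u≁v u∼v = u≢v (edge⇒rainbow e∈H u v u∈e v∈e u∼v)

    -- The outer `punchIn` skips the part of u; the inner one skips the part of v, whose index after
    -- removal of `part u` is `punchOut u≁v`.
    avoid : Fin s → Fin (2 +ⁿ s)
    avoid = punchIn (part u) ∘ punchIn (punchOut u≁v)

    -- The quotient is the position inside a part, and the remainder selects one of the s allowed
    -- parts.
    w : Fin (q *ⁿ s) → Fin V
    w i = combine (quotient {q} s i) (avoid (remainder {q} s i))

    avoid-inj : Injective _≡_ _≡_ avoid
    avoid-inj = punchIn-injective _ _ _ ∘ punchIn-injective (part u) _ _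

    part-w : ∀ i → part (w i) ≡ avoid (remainder {q} s i)
    part-w i = part-combine (quotient {q} s i) _

    w≁u : ∀ i → part (w i) ≢ part u
    w≁u i eq = punchInᵢ≢i (part u) _ (trans (sym (part-w i)) eq)

    w≁v : ∀ i → part (w i) ≢ part v
    w≁v i eq = punchInᵢ≢i (punchOut u≁v) _ (punchIn-injective (part u) _ _
      (trans (sym (part-w i)) (trans eq (sym (punchIn-punchOut u≁v)))))

    w-inj : ∀ i j → w i ≡ w j → i ≡ j
    w-inj i j eq with combine-injective (quotient {q} s i) _ (quotient {q} s j) _ eq
    ... | eqˡ , eqʳ = begin
      i                                 ≡⟨ combine-remQuot {q} s i ⟨
      uncurry combine (remQuot {q} s i) ≡⟨ cong₂ combine eqˡ (avoid-inj eqʳ) ⟩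
      uncurry combine (remQuot {q} s j) ≡⟨ combine-remQuot {q} s j ⟩
      j                                 ∎
      where open ≡-Reasoning

  multipartite-free : 2 +ⁿ s <ⁿ 7 → Free fano multipartite
  multipartite-free 2+s<7 (φ , φ-inj , φ-edge)
    with i , j , i<j , i∼j ← pigeonhole 2+s<7 (part ∘ φ)
    with e , e∈fano , i∈e , j∈e ← find (collinear i j)
    = <⇒≢ i<j (φ-inj (edge⇒rainbow (φ-edge e e∈fano) (φ i) (φ j)
        (from (∈-image φ e) (i , i∈e , refl)) (from (∈-image φ e) (j , j∈e , refl)) i∼j))

-- Deciding the existence of 3-graphs

-- Abstracts the range of the search, so that `any-function?` handles both maps into vertices
-- (`any?`) and maps into subsets (`anySubset?`).
Searchable : Set → Set₁
Searchable A = ∀ {P : A → Set} → Decidable P → Dec (∃ P)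

-- Searches over the value at `zero` and then over the remaining values. A function agrees only
-- pointwise with the one rebuilt from its head and tail, hence the assumption that P respects `≗`.
any-function? : Searchable A → ∀ {m} {P : (Fin m → A) → Set} →
  (∀ {f g} → f ≗ g → P f → P g) → Decidable P → Dec (∃ P)
any-function? search {zero} {P} resp P? =
  map′ (Vector.[] ,_) (λ (f , p) → resp (λ ()) p) (P? Vector.[])
any-function? search {suc m} {P} resp P? =
  map′ (λ (a , f , p) → a Vector.∷ f , p)
       (λ (f , p) → f zero , f ∘ suc , resp (λ { zero → refl ; (suc _) → refl }) p)
       (search λ a → any-function? search (λ f≗g → resp λ { zero → refl ; (suc i) → f≗g i })
                                          (λ f → P? (a Vector.∷ f)))

any-sublist? : ∀ (xs : List A) {P : List A → Set} → Decidable P →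
  Dec (∃ λ ys → ys ⊑ xs × P ys)
any-sublist? []       P? =
  map′ (λ p → [] , [] , p) (λ { ([] , [] , p) → p }) (P? [])
any-sublist? (x ∷ xs) P? =
  map′ (λ { (inj₁ (ys , ys⊑xs , p)) → ys , x ∷ʳ ys⊑xs , p
          ; (inj₂ (ys , ys⊑xs , p)) → x ∷ ys , refl ∷ ys⊑xs , p })
       (λ { (ys , _ ∷ʳ ys⊑xs , p) → inj₁ (ys , ys⊑xs , p)
          ; (_ ∷ ys , refl ∷ ys⊑xs , p) → inj₂ (ys , ys⊑xs , p) })
       (any-sublist? xs P? ⊎-dec any-sublist? xs (P? ∘ (x ∷_)))

injective? : DecidableEquality A → Decidable {A = Fin m → A} (Injective _≡_ _≡_)
injective? _≟_ f = map′ (λ inj {i} {j} → inj i j) (λ inj i j → inj)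
  (all? λ i → all? λ j → (f i ≟ f j) →-dec (i ≟ᶠ j))

injective-resp : ∀ {f g : Fin m → A} → f ≗ g → Injective _≡_ _≡_ f → Injective _≡_ _≡_ g
injective-resp f≗g inj {i} {j} eq = inj (trans (f≗g i) (trans eq (sym (f≗g j))))

_≟ˢ_ : DecidableEquality (Subset n)
_≟ˢ_ = Vec.≡-dec _≟ᵇ_

edge? : ∀ (H : 3-Graph n) → Decidable (Edge H)
edge? H e = Any.any? (e ≟ˢ_) (edges H)

nonEmpty? : ∀ (H : 3-Graph n) → Dec (NonEmpty H)
nonEmpty? H with edges H
... | []    = no λ ()
... | e ∷ _ = yes (e , here refl)

all-edges? : ∀ (H : 3-Graph n) {P : Subset n → Set} → Decidable P → Dec (∀ e → Edge H e → P e)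
all-edges? H P? = map′ (λ ps e → All.lookup ps) (λ p → All.tabulate λ e∈H → p _ e∈H)
  (All.all? P? (edges H))

contains? : ∀ (F : 3-Graph m) (H : 3-Graph n) → Dec (Contains F H)
contains? F H = any-function? any?
  (λ φ≗ψ (inj , edge) → injective-resp φ≗ψ inj ,
     λ e e∈F → subst (Edge H) (image-cong φ≗ψ e) (edge e e∈F))
  (λ φ → injective? _≟ᶠ_ φ ×-dec all-edges? F (edge? H ∘ image φ))

inAtLeast? : ∀ (H : 3-Graph n) u v k → Dec (InAtLeast H u v k)
inAtLeast? H u v k = any-function? anySubset?
  (λ f≗g (inj , edge) → injective-resp f≗g inj ,
     λ i → subst (λ e → Edge H e × u ∈ˢ e × v ∈ˢ e) (f≗g i) (edge i))
  (λ f → injective? _≟ˢ_ f ×-dec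
     all? λ i → edge? H (f i) ×-dec (u ∈? f i) ×-dec (v ∈? f i))

positiveCodegrees≥? : ∀ (H : 3-Graph n) k → Dec (PositiveCodegrees≥ H k)
positiveCodegrees≥? H k =
  map′ (λ p e u v e∈H u∈e v∈e u≢v → p e e∈H u v u∈e v∈e u≢v)
       (λ p e e∈H u v u∈e v∈e u≢v → p e u v e∈H u∈e v∈e u≢v)
       (all-edges? H λ e → all? λ u → all? λ v →
         (u ∈? e) →-dec (v ∈? e) →-dec ¬? (u ≟ᶠ v) →-dec inAtLeast? H u v k)

-- The codegree condition is a lower bound, not an exact value; at the largest attainable k the two
-- agree, as `attained` shows below.
Admissible : 3-Graph m → ℕ → 3-Graph n → Set
Admissible F k H = NonEmpty H × Free F H × PositiveCodegrees≥ H k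

admissible? : ∀ (F : 3-Graph m) k → Decidable {A = 3-Graph n} (Admissible F k)
admissible? F k H = nonEmpty? H ×-dec ¬? (contains? F H) ×-dec positiveCodegrees≥? H k

-- All three conditions see a 3-graph only through edge membership. This permits replacing an edge
-- list by a canonical one and exchanging proofs of uniformity.
admissible-resp : ∀ (F : 3-Graph m) (G H : 3-Graph n) →
  (∀ {e} → Edge G e → Edge H e) → (∀ {e} → Edge H e → Edge G e) →
  Admissible F k G → Admissible F k H
admissible-resp F G H G⊆H H⊆G ((e , e∈G) , free , δ≥k) =
  (e , G⊆H e∈G) ,
  (λ (φ , inj , edge) → free (φ , inj , λ e e∈F → H⊆G (edge e e∈F))) ,
  λ e u v e∈H u∈e v∈e u≢v →
    let f , inj , edge = δ≥k e u v (H⊆G e∈H) u∈e v∈e u≢v in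
    f , inj , λ i → let fi∈G , u∈fi , v∈fi = edge i in G⊆H fi∈G , u∈fi , v∈fi

any-admissible? : ∀ n (F : 3-Graph m) k → Dec (∃ λ (H : 3-Graph n) → Admissible F k H)
any-admissible? n F k =
  map′ (λ (es , _ , u , adm) → graph es u , adm)
       (λ (H , adm) → restrict H , filter-⊆ (edge? H) (subsets n) , restrict-uniform H ,
          admissible-resp F H (graph (restrict H) (restrict-uniform H))
                          (∈-filter⁺ (edge? H) (∈-subsets _))
                          (proj₂ ∘ ∈-filter⁻ (edge? H) {xs = subsets n}) adm)
       (any-sublist? (subsets n) admissible-list?)
  where
  graph : (es : List (Subset n)) → All (λ e → ∣ e ∣ ≡ 3) es → 3-Graph n
  graph es u = record { edges = es ; uniform = u }

  -- A 3-graph matters only through membership in its edge list, so the search may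
  -- be confined to sublists of the list of all subsets.
  restrict : 3-Graph n → List (Subset n)
  restrict H = filter (edge? H) (subsets n)

  restrict-uniform : ∀ H → All (λ e → ∣ e ∣ ≡ 3) (restrict H)
  restrict-uniform H = All.map (All.lookup (uniform H)) (All.all-filter (edge? H) (subsets n))

  admissible-list? : Decidable λ es → ∃ λ u → Admissible F k (graph es u)
  admissible-list? es with All.all? (λ e → ∣ e ∣ ℕ.≟ 3) es
  ... | no  ¬u = no (¬u ∘ proj₁)
  -- A given witness may carry another uniformity proof `u′`; both graphs have the same edge list,
  -- so `id` transports membership.
  ... | yes u  = map′ (u ,_) (λ (u′ , adm) → admissible-resp F (graph es u′) (graph es u) id id adm)
                      (admissible? F k (graph es u))

-- The extremal number

-- Descends from the bound to the first value satisfying P; `P 0` guarantees that the descent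
-- succeeds.
maximum : ∀ {P : ℕ → Set} → Decidable P → P 0 → ∀ b → (∀ j → P j → j ≤ⁿ b) → ∃ (IsMaximum P)
maximum P? p₀ zero    bound = 0 , p₀ , bound
maximum P? p₀ (suc b) bound with P? (suc b)
... | yes p = suc b , p , bound
... | no ¬p = maximum P? p₀ b λ j p →
  s≤s⁻¹ (ℕ.≤∧≢⇒< (bound j p) λ { refl → ¬p p })

emptyGraph : ∀ n → 3-Graph n
emptyGraph n .edges   = []
emptyGraph n .uniform = []

admissible⇒3k≤2n : ∀ (H : 3-Graph n) k → Admissible fano k H → 3 *ⁿ k ≤ⁿ 2 *ⁿ n
admissible⇒3k≤2n H k (nonEmpty , free , δ≥k) =
  ℕ.≮⇒≥ λ 2n<3k → free (contains-fano H δ≥k 2n<3k nonEmpty)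

-- The last component lets a lower bound on k be derived from a graph whose codegrees are merely
-- bounded below, without computing its exact `δ₂⁺`.
IsCo⁺ex-exists : ∀ n → ∃ λ k → IsCo⁺ex n fano k
  × 3 *ⁿ k ≤ⁿ 2 *ⁿ n
  × (∀ j (H : 3-Graph n) → Admissible fano j H → j ≤ⁿ k)
IsCo⁺ex-exists n = k* , (attained P-k* , λ j (H , free , min) → k*-max j (necessary H free min))
                 , 3j≤2n k* P-k* , λ j H adm → k*-max j (inj₂ (H , adm))
  where
  -- The alternative j ≡ 0 accounts for the empty graph, which is Fano-free and has value 0 by
  -- convention.
  P : ℕ → Set
  P j = j ≡ 0 ⊎ ∃ λ (H : 3-Graph n) → Admissible fano j H

  3j≤2n : ∀ j → P j → 3 *ⁿ j ≤ⁿ 2 *ⁿ n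
  3j≤2n _ (inj₁ refl)      = z≤n
  3j≤2n j (inj₂ (H , adm)) = admissible⇒3k≤2n H j adm

  -- A crude starting point for the search, from 3j ≤ 2n ≤ 3n.
  j≤n : ∀ j → P j → j ≤ⁿ n
  j≤n j Pj = ℕ.*-cancelˡ-≤ 3 (ℕ.≤-trans (3j≤2n j Pj) (ℕ.*-monoˡ-≤ n (ℕ.n≤1+n 2)))

  max : ∃ (IsMaximum P)
  max = maximum (λ j → (j ℕ.≟ 0) ⊎-dec any-admissible? n fano j) (inj₁ refl) n j≤n

  k*     = proj₁ max
  P-k*   = proj₁ (proj₂ max)
  k*-max = proj₂ (proj₂ max)

  necessary : ∀ {j} (H : 3-Graph n) → Free fano H → IsMinPositiveCodegree H j → P j
  necessary H free (inj₁ (nonEmpty , δ≥j , _)) = inj₂ (H , nonEmpty , free , δ≥j)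
  necessary H free (inj₂ (_ , refl))           = inj₁ refl

  attained : P k* → ∃ λ (H : 3-Graph n) → Free fano H × IsMinPositiveCodegree H k*
  attained (inj₁ k*≡0) = emptyGraph n
    , (λ (_ , _ , edge) → contradiction (edge _ (here refl)) λ ())
    , inj₂ ((λ ()) , k*≡0)
  -- The minimum positive codegree of H is exactly `k*`: any larger lower bound j would make H
  -- admissible for j, against maximality.
  attained (inj₂ (H , nonEmpty , free , δ≥k)) = H , free
    , inj₁ (nonEmpty , δ≥k , λ j δ≥j → k*-max j (inj₂ (H , nonEmpty , free , δ≥j)))

-- The bounds as rational inequalities

toℚᵘ-fromℕ : ∀ k → toℚᵘ (fromℕ k) ℚᵘ.≃ mkℚᵘ (+ k) 0
toℚᵘ-fromℕ k = ℚ.toℚᵘ-fromℚᵘ (mkℚᵘ (+ k) 0)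

-- Unnormalised rationals multiply without reduction, so the product is visible as 2n over 3. The
-- second argument of `mkℚᵘ` is the denominator minus one: 2 stands for 3, and 0 for 1.
toℚᵘ-⅔*fromℕ : ∀ n → toℚᵘ (⅔ * fromℕ n) ℚᵘ.≃ mkℚᵘ (+ (2 *ⁿ n)) 2
toℚᵘ-⅔*fromℕ n = begin
  toℚᵘ (⅔ * fromℕ n)              ≈⟨ ℚ.toℚᵘ-homo-* ⅔ (fromℕ n) ⟩
  toℚᵘ ⅔ ℚᵘ.* toℚᵘ (fromℕ n)      ≈⟨ ℚᵘ.*-congˡ {toℚᵘ ⅔} (toℚᵘ-fromℕ n) ⟩
  toℚᵘ ⅔ ℚᵘ.* mkℚᵘ (+ n) 0        ≈⟨ *≡* (cong (ℤ._* + 3) (sym (ℤ.pos-* 2 n))) ⟩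
  mkℚᵘ (+ (2 *ⁿ n)) 2             ∎
  where open ℚᵘ.≃-Reasoning

3k≤2n⇒k≤⅔n : ∀ k n → 3 *ⁿ k ≤ⁿ 2 *ⁿ n → fromℕ k ≤ ⅔ * fromℕ n
3k≤2n⇒k≤⅔n k n 3k≤2n = ℚ.toℚᵘ-cancel-≤ (begin
  toℚᵘ (fromℕ k)      ≃⟨ toℚᵘ-fromℕ k ⟩
  mkℚᵘ (+ k) 0        ≤⟨ *≤* ℤ-bound ⟩
  mkℚᵘ (+ (2 *ⁿ n)) 2 ≃⟨ toℚᵘ-⅔*fromℕ n ⟨
  toℚᵘ (⅔ * fromℕ n)  ∎)
  where
  open ℚᵘ.≤-Reasoning
  ℤ-bound : + k ℤ.* + 3 ℤ.≤ + (2 *ⁿ n) ℤ.* + 1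
  ℤ-bound = subst₂ ℤ._≤_ (ℤ.pos-* k 3) (ℤ.pos-* (2 *ⁿ n) 1)
    (ℤ.+≤+ (subst₂ _≤ⁿ_ (ℕ.*-comm 3 k) (sym (ℕ.*-identityʳ (2 *ⁿ n))) 3k≤2n))

2n≤3k⇒⅔n≤k : ∀ k n → 2 *ⁿ n ≤ⁿ 3 *ⁿ k → ⅔ * fromℕ n ≤ fromℕ k
2n≤3k⇒⅔n≤k k n 2n≤3k = ℚ.toℚᵘ-cancel-≤ (begin
  toℚᵘ (⅔ * fromℕ n)  ≃⟨ toℚᵘ-⅔*fromℕ n ⟩
  mkℚᵘ (+ (2 *ⁿ n)) 2 ≤⟨ *≤* ℤ-bound ⟩
  mkℚᵘ (+ k) 0        ≃⟨ toℚᵘ-fromℕ k ⟨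
  toℚᵘ (fromℕ k)      ∎)
  where
  open ℚᵘ.≤-Reasoning
  ℤ-bound : + (2 *ⁿ n) ℤ.* + 1 ℤ.≤ + k ℤ.* + 3
  ℤ-bound = subst₂ ℤ._≤_ (ℤ.pos-* (2 *ⁿ n) 1) (ℤ.pos-* k 3)
    (ℤ.+≤+ (subst₂ _≤ⁿ_ (sym (ℕ.*-identityʳ (2 *ⁿ n))) (ℕ.*-comm 3 k) 2n≤3k))

6∣n⇒2n≤3k : ∀ n → .{{_ : NonZero n}} → 6 ∣ n → ∀ k →
  (∀ j (H : 3-Graph n) → Admissible fano j H → j ≤ⁿ k) → 2 *ⁿ n ≤ⁿ 3 *ⁿ k
-- Since n is nonzero, so is n/6 = `suc q`. The parts are therefore inhabited, and position `0F` in
-- parts 0, 1, 2 gives an edge. Taking s = 4 makes six parts and codegree 4n/6; `ℕ.≤-refl` is 6 < 7.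
6∣n⇒2n≤3k _ (divides (suc q) refl) k k-max = begin
  2 *ⁿ (suc q *ⁿ 6) ≡⟨ solve 1 (λ q → con 2 :* (q :* con 6) := con 3 :* (q :* con 4)) refl (suc q) ⟩
  3 *ⁿ (suc q *ⁿ 4) ≤⟨ ℕ.*-monoʳ-≤ 3 (k-max _ multipartite
                         ( multipartite-nonEmpty 0F {0F} {1F} {2F} (λ ()) (λ ()) (λ ())
                         , multipartite-free ℕ.≤-refl
                         , multipartite-codegrees)) ⟩
  3 *ⁿ k            ∎
  where
  open Multipartite (suc q) 4
  open ℕ.≤-Reasoning

theorem10 : (n : ℕ) → .{{_ : NonZero n}} →
    ∃ λ (k : ℕ) → IsCo⁺ex n fano k
    × fromℕ k ≤ ⅔ * fromℕ n
    × (6 ∣ n → fromℕ k ≡ ⅔ * fromℕ n)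
theorem10 n with k , co⁺ex , 3k≤2n , k-max ← IsCo⁺ex-exists n =
  k , co⁺ex , 3k≤2n⇒k≤⅔n k n 3k≤2n ,
  λ 6∣n → ℚ.≤-antisym (3k≤2n⇒k≤⅔n k n 3k≤2n) (2n≤3k⇒⅔n≤k k n (6∣n⇒2n≤3k n 6∣n k k-max))
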